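{- Let $a_1,\dots,a_n$ be positive integers, let $\mathcal{G}=\mathcal{G}[a_1,\dots,a_n]$, let $\mathcal{G}_{\leftrightarrow}=\mathcal{G}[a_n,\dots,a_2,a_1,a_1,a_2,\dots,a_n]$ (the palindromification of $\mathcal{G}$), and let $\mathcal{G}'=\mathcal{G}[a_2,\dots,a_n]$. Then \[ m(\mathcal{G}_{\leftrightarrow})=m(\mathcal{G})^2+m(\mathcal{G}')^2. \]
   Context: A tile is a unit square in the plane with sides parallel to the coordinate axes, viewed as a graph with 4 vertices and 4 edges. A snake graph with $d\ge 1$ tiles is a planar graph which is the union of tiles $G_1,\dots,G_d$ such that for each $i$, $G_{i+1}$ is the translate of $G_i$ by $(0,1)$ or by $(1,0)$; thus $G_i$ and $G_{i+1}$ share exactly one edge $e_i$. A sign function on a snake graph is a map $f$ from its edges to $\{+,-\}$ such that in every tile the north and west edges have the same sign, the south and east edges have the same sign, and the north and south edges have opposite signs. For a sequence $(a_1,\dots,a_n)$ of positive integers with $d=a_1+\cdots+a_n-1\ge 1$, $\mathcal{G}[a_1,\dots,a_n]$ is the unique snake graph with tiles $G_1,\dots,G_d$ for which there exist a sign function $f$ and an edge $e_d\in\{\text{north edge of }G_d,\text{east edge of }G_d\}$ such that, with $e_0$ the south edge of $G_1$ and $e_i$ ($1\le i\le d-1$) the edge shared by $G_i,G_{i+1}$, the sequence $(f(e_0),\dots,f(e_d))$ consists of $a_1$ copies of a sign $s$, then $a_2$ copies of $-s$, then $a_3$ copies of $s$, and so on alternately. By convention $\mathcal{G}[1]$ is a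 single edge, and the snake graph of the empty sequence (which occurs as $\mathcal{G}'$ when $n=1$) is a single edge. For a graph $\mathcal{H}$, $m(\mathcal{H})$ denotes its number of perfect matchings (a single edge has exactly one). -}

module Defs where

open import Data.Irrelevant using ([_])
open import Data.List using (List; []; _∷_; _++_; _∷ʳ_; map; concatMap; deduplicate; filter; length; replicate)
open import Data.List.Properties using (∷ʳ-injectiveˡ; map-++; map-replicate)
open import Data.List.Relation.Unary.All using (All; []; _∷_; all?)
open import Data.Nat using (ℕ; zero; suc; _+_; NonZero)
open import Data.Nat.Properties using (+-suc) renaming (_≟_ to _≟ℕ_)
open import Data.Product using (_×_; _,_; ∃; ∃₂; ∃!; proj₁; proj₂)
open import Data.Product.Properties using (≡-dec)
open import Data.Refinement using (Refinement; Refinement-syntax; value; _,_)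
open import Data.Sign using (Sign; opposite) renaming (_*_ to _*ₛ_; + to plus; - to minus)
open import Data.Sign.Properties using (opposite-involutive)
open import Data.Sum using (_⊎_)
open import Relation.Binary.Definitions using (DecidableEquality)
open import Relation.Binary.PropositionalEquality using (_≡_; refl; sym; trans; cong; cong₂; module ≡-Reasoning)
open import Relation.Nullary using (Dec)
open import Relation.Nullary.Decidable using (_⊎-dec_)

ℕ⁺ : Set
ℕ⁺ = [ n ∈ ℕ ∣ NonZero n ]

Point : Set
Point = ℕ × ℕ

-- A unit lattice edge is always written with its south or west endpoint
-- first, so that equality of pairs is equality of edges.
Edge : Set
Edge = Point × Point

_≟ᵖ_ : DecidableEquality Point
_≟ᵖ_ = ≡-dec _≟ℕ_ _≟ℕ_

_≟ᵉ_ : DecidableEquality Edge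
_≟ᵉ_ = ≡-dec _≟ᵖ_ _≟ᵖ_

-- The edge list has to be free of repetitions for perfectMatchings to list
-- every perfect matching exactly once; snakeGraph below deduplicates it.
record Graph : Set where
  constructor mkGraph
  field
    vertices : List Point
    edges    : List Edge
open Graph public

Incident : Point → Edge → Set
Incident v e = v ≡ proj₁ e ⊎ v ≡ proj₂ e

incident? : ∀ v e → Dec (Incident v e)
incident? v e = (v ≟ᵖ proj₁ e) ⊎-dec (v ≟ᵖ proj₂ e)

degree : List Edge → Point → ℕ
degree M v = length (filter (incident? v) M)

IsPerfect : Graph → List Edge → Set
IsPerfect H M = All (λ v → degree M v ≡ 1) (vertices H)

isPerfect? : ∀ H M → Dec (IsPerfect H M)
isPerfect? H M = all? (λ v → degree M v ≟ℕ 1) (vertices H)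

subsets : {A : Set} → List A → List (List A)
subsets []       = [] ∷ []
subsets (x ∷ xs) = map (x ∷_) (subsets xs) ++ subsets xs

perfectMatchings : Graph → List (List Edge)
perfectMatchings H = filter (isPerfect? H) (subsets (edges H))

m : Graph → ℕ
m H = length (perfectMatchings H)

-- A tile is given by its south-west corner.
Tile : Set
Tile = Point

south north west east : Tile → Edge
south (x , y) = (x , y)     , (suc x , y)
north (x , y) = (x , suc y) , (suc x , suc y)
west  (x , y) = (x , y)     , (x , suc y)
east  (x , y) = (suc x , y) , (suc x , suc y)

corners : Tile → List Point
corners (x , y) = (x , y) ∷ (suc x , y) ∷ (x , suc y) ∷ (suc x , suc y) ∷ []

sides : Tile → List Edge
sides G = south G ∷ west G ∷ north G ∷ east G ∷ []

data Step : Set where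
  rightward upward : Step

translate : Step → Tile → Tile
translate rightward (x , y) = suc x , y
translate upward    (x , y) = x , suc y

tilesFrom : Tile → List Step → List Tile
tilesFrom G []       = G ∷ []
tilesFrom G (t ∷ ts) = G ∷ tilesFrom (translate t G) ts

origin : Tile
origin = 0 , 0

-- Snake graphs are considered up to translation: the first tile is at the
-- origin, and a snake graph with d ≥ 1 tiles is given by its d − 1 steps.
tiles : List Step → List Tile
tiles = tilesFrom origin

snakeGraph : List Step → Graph
snakeGraph ts = mkGraph
  (deduplicate _≟ᵖ_ (concatMap corners (tiles ts)))
  (deduplicate _≟ᵉ_ (concatMap sides (tiles ts)))

singleEdge : Graph
singleEdge = mkGraph ((0 , 0) ∷ (1 , 0) ∷ []) (((0 , 0) , (1 , 0)) ∷ [])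

record Signed (f : Edge → Sign) (G : Tile) : Set where
  constructor signed
  field
    north≡west   : f (north G) ≡ f (west G)
    south≡east   : f (south G) ≡ f (east G)
    north≡-south : f (north G) ≡ opposite (f (south G))

-- Only the values of f on edges of the snake graph are constrained, so f is
-- a total function merely for convenience.
IsSignFunction : List Step → (Edge → Sign) → Set
IsSignFunction ts f = All (Signed f) (tiles ts)

-- For the tiles G and translate t G this is the edge they share:
-- east G ≡ west (translate rightward G), north G ≡ south (translate upward G).
exit : Step → Tile → Edge
exit rightward = east
exit upward    = north

-- The edges e₁ , … , e_d of the snake starting at G; the last step chooses
-- e_d among the east and the north edge of the last tile.
exits : Tile → List Step → Step → List Edge
exits G []       last = exit last G ∷ []
exits G (t ∷ ts) last = exit t G ∷ exits (translate t G) ts last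

signSequence : (Edge → Sign) → List Step → Step → List Sign
signSequence f ts last = map f (south origin ∷ exits origin ts last)

blocks : Sign → List ℕ⁺ → List Sign
blocks s []       = []
blocks s (a ∷ as) = replicate (value a) s ++ blocks (opposite s) as

data IsSnakeGraphOf : List ℕ⁺ → Graph → Set where
  empty : IsSnakeGraphOf [] singleEdge
  one   : ∀ {a} → value a ≡ 1 → IsSnakeGraphOf (a ∷ []) singleEdge
  snake : ∀ {as} ts f last s →
          IsSignFunction ts f →
          signSequence f ts last ≡ blocks s as →
          IsSnakeGraphOf as (snakeGraph ts)

alternate : Sign → ℕ → Sign
alternate s zero    = s
alternate s (suc n) = opposite (alternate s n)

-- A sign function on the whole lattice.
latticeSign : Sign → Edge → Sign
latticeSign s ((x , _) , (_ , y)) = alternate s (x + y)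

module _ (s : Sign) where

  lattice-south≡east : ∀ G → latticeSign s (south G) ≡ latticeSign s (east G)
  lattice-south≡east (x , y) = begin
    alternate s (x + y)           ≡⟨ sym (opposite-involutive _) ⟩
    alternate s (2 + (x + y))     ≡⟨ cong (λ n → alternate s (suc n)) (sym (+-suc x y)) ⟩
    alternate s (suc x + suc y)   ∎
    where open ≡-Reasoning

  lattice-north≡-south : ∀ G → latticeSign s (north G) ≡ opposite (latticeSign s (south G))
  lattice-north≡-south (x , y) = cong (alternate s) (+-suc x y)

  latticeSigned : ∀ G ts → All (Signed (latticeSign s)) (tilesFrom G ts)
  latticeSigned G []       = signed refl (lattice-south≡east G) (lattice-north≡-south G) ∷ []
  latticeSigned G (t ∷ ts) =
    signed refl (lattice-south≡east G) (lattice-north≡-south G) ∷ latticeSigned (translate t G) ts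

  chooseExit : ∀ G σ → ∃ λ t → latticeSign s (exit t G) ≡ σ
  chooseExit G σ with latticeSign s (south G) | lattice-south≡east G | lattice-north≡-south G
  chooseExit G plus  | plus  | p | q = rightward , sym p
  chooseExit G plus  | minus | p | q = upward , q
  chooseExit G minus | plus  | p | q = upward , q
  chooseExit G minus | minus | p | q = rightward , sym p

  chooseSteps : ∀ G σ σs → ∃₂ λ ts last → map (latticeSign s) (exits G ts last) ≡ σ ∷ σs
  chooseSteps G σ [] with chooseExit G σ
  ... | t , p = [] , t , cong (_∷ []) p
  chooseSteps G σ (σ′ ∷ σs) with chooseExit G σ
  ... | t , p with chooseSteps (translate t G) σ′ σs
  ...   | ts , last , ps = t ∷ ts , last , cong₂ _∷_ p ps

realize : ∀ as σ σs → blocks plus as ≡ plus ∷ σ ∷ σs → ∃ (IsSnakeGraphOf as)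
realize as σ σs eq with chooseSteps plus origin σ σs
... | ts , last , p =
  snakeGraph ts ,
  snake ts (latticeSign plus) last plus (latticeSigned plus origin ts)
    (trans (cong (plus ∷_) p) (sym eq))

exists : ∀ as → ∃ (IsSnakeGraphOf as)
exists [] = singleEdge , empty
exists ((zero , [ () ]) ∷ as)
exists ((suc zero , _) ∷ []) = singleEdge , one refl
exists as@((suc zero , _) ∷ (zero , [ () ]) ∷ _)
exists as@((suc zero , _) ∷ (suc b , _) ∷ _) = realize as _ _ refl
exists as@((suc (suc a) , _) ∷ _) = realize as _ _ refl

-- Here + means that the exit has the same sign as the south edge.
toStep : Sign → Step
toStep plus  = rightward
toStep minus = upward

-- The sign of the south edge alternates along the tiles of a snake, so
-- that the signs of the exits determine the steps.
decode : Sign → List Sign → List Step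
decode σ []       = []
decode σ (τ ∷ τs) = toStep (σ *ₛ τ) ∷ decode (opposite σ) τs

decode-opposite : ∀ σ τs → decode (opposite σ) (map opposite τs) ≡ decode σ τs
decode-opposite σ []       = refl
decode-opposite σ (τ ∷ τs) =
  cong₂ _∷_ (cong toStep (lemma σ τ)) (decode-opposite (opposite σ) τs)
  where
  lemma : ∀ σ τ → opposite σ *ₛ opposite τ ≡ σ *ₛ τ
  lemma plus  plus  = refl
  lemma plus  minus = refl
  lemma minus plus  = refl
  lemma minus minus = refl

decode-exit : ∀ {f G} t → Signed f G → toStep (f (south G) *ₛ f (exit t G)) ≡ t
decode-exit {f} {G} rightward (signed _ p _) rewrite sym p with f (south G)
... | plus  = refl
... | minus = refl
decode-exit {f} {G} upward (signed _ _ q) rewrite q with f (south G)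
... | plus  = refl
... | minus = refl

south-translate : ∀ {f} {G} t → Signed f G → Signed f (translate t G) →
                  f (south (translate t G)) ≡ opposite (f (south G))
south-translate {f} {G} rightward (signed _ p _) (signed p′ _ q′) = begin
  f (south G′)                        ≡⟨ sym (opposite-involutive _) ⟩
  opposite (opposite (f (south G′)))  ≡⟨ cong opposite (sym q′) ⟩
  opposite (f (north G′))             ≡⟨ cong opposite p′ ⟩
  opposite (f (east G))               ≡⟨ cong opposite (sym p) ⟩
  opposite (f (south G))              ∎
  where
  open ≡-Reasoning
  G′ = translate rightward G
south-translate upward (signed _ _ q) _ = q

headSigned : ∀ {f G} ts → All (Signed f) (tilesFrom G ts) → Signed f G
headSigned []      (p ∷ _) = p
headSigned (_ ∷ _) (p ∷ _) = p

decode-exits : ∀ {f G} ts last → All (Signed f) (tilesFrom G ts) →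
               decode (f (south G)) (map f (exits G ts last)) ≡ ts ∷ʳ last
decode-exits []       last (p ∷ []) = cong (_∷ []) (decode-exit last p)
decode-exits {f} {G} (t ∷ ts) last (p ∷ ps) = cong₂ _∷_ (decode-exit t p) (begin
  decode (opposite (f (south G))) σs       ≡⟨ cong (λ σ → decode σ σs) (sym (south-translate t p (headSigned ts ps))) ⟩
  decode (f (south (translate t G))) σs    ≡⟨ decode-exits ts last ps ⟩
  ts ∷ʳ last                               ∎)
  where
  open ≡-Reasoning
  σs = map f (exits (translate t G) ts last)

blocks-opposite : ∀ s as → blocks (opposite s) as ≡ map opposite (blocks s as)
blocks-opposite s []       = refl
blocks-opposite s (a ∷ as) = sym (begin
  map opposite (replicate (value a) s ++ blocks (opposite s) as)
    ≡⟨ map-++ opposite (replicate (value a) s) _ ⟩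
  map opposite (replicate (value a) s) ++ map opposite (blocks (opposite s) as)
    ≡⟨ cong₂ _++_ (map-replicate opposite (value a) s) (sym (blocks-opposite (opposite s) as)) ⟩
  replicate (value a) (opposite s) ++ blocks (opposite (opposite s)) as ∎)
  where open ≡-Reasoning

decodeAll : List Sign → List Step
decodeAll []       = []
decodeAll (σ ∷ σs) = decode σ σs

decodeAll-opposite : ∀ σs → decodeAll (map opposite σs) ≡ decodeAll σs
decodeAll-opposite []       = refl
decodeAll-opposite (σ ∷ σs) = decode-opposite σ σs

decodeAll-blocks : ∀ s s′ as → decodeAll (blocks s as) ≡ decodeAll (blocks s′ as)
decodeAll-blocks plus  plus  as = refl
decodeAll-blocks minus minus as = refl
decodeAll-blocks plus  minus as =
  sym (trans (cong decodeAll (blocks-opposite plus as)) (decodeAll-opposite (blocks plus as)))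
decodeAll-blocks minus plus  as =
  trans (cong decodeAll (blocks-opposite plus as)) (decodeAll-opposite (blocks plus as))

steps-unique : ∀ as ts last f s ts′ last′ f′ s′ →
               IsSignFunction ts f → signSequence f ts last ≡ blocks s as →
               IsSignFunction ts′ f′ → signSequence f′ ts′ last′ ≡ blocks s′ as →
               ts ≡ ts′
steps-unique as ts last f s ts′ last′ f′ s′ p q p′ q′ = ∷ʳ-injectiveˡ ts ts′ (begin
  ts ∷ʳ last                              ≡⟨ sym (decode-exits ts last p) ⟩
  decodeAll (signSequence f ts last)      ≡⟨ cong decodeAll q ⟩
  decodeAll (blocks s as)                 ≡⟨ decodeAll-blocks s s′ as ⟩
  decodeAll (blocks s′ as)                ≡⟨ cong decodeAll (sym q′) ⟩
  decodeAll (signSequence f′ ts′ last′)   ≡⟨ decode-exits ts′ last′ p′ ⟩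
  ts′ ∷ʳ last′                            ∎)
  where open ≡-Reasoning

module _ {B : Set} where

  not-empty : ∀ {f ts last s} → signSequence f ts last ≡ blocks s [] → B
  not-empty ()

  not-one : ∀ {a f} ts {last s} → value a ≡ 1 →
            signSequence f ts last ≡ blocks s (a ∷ []) → B
  not-one []      refl ()
  not-one (_ ∷ _) refl ()

unique : ∀ {as H H′} → IsSnakeGraphOf as H → IsSnakeGraphOf as H′ → H ≡ H′
unique empty   empty   = refl
unique empty   (snake ts f last s _ q) = not-empty {f = f} {ts} {last} {s} q
unique (one _) (one _) = refl
unique (one {a} p) (snake ts f last s _ q) = not-one {a = a} ts p q
unique (snake ts f last s _ q) empty = not-empty {f = f} {ts} {last} {s} q
unique (snake ts f last s _ q) (one {a} p) = not-one {a = a} ts p q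
unique {as} (snake ts f last s p q) (snake ts′ f′ last′ s′ p′ q′) =
  cong snakeGraph (steps-unique as ts last f s ts′ last′ f′ s′ p q p′ q′)

-- As sequences are positive, the conventions for [] and [1] do not overlap
-- with the snake graphs, and equality of graphs can be literal since the
-- position of the first tile is fixed.
existsUnique : ∀ as → ∃! _≡_ (IsSnakeGraphOf as)
existsUnique as = proj₁ (exists as) , proj₂ (exists as) , unique (proj₂ (exists as))

𝒢[_] : List ℕ⁺ → Graph
𝒢[ as ] = proj₁ (existsUnique as)

{-# OPTIONS --safe #-}
module Submission where

-- Splitting off the first tile shows how the numbers of perfect matchings
-- through the south and the west edge of the first tile change. Labelled by the
-- signs of these two edges rather than by south and west, the change depends
-- only on the sign τ of the exit: the τ-entry is kept, and the other entry
-- becomes the sum of both. A block of a equal signs therefore acts as the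
-- continuant matrix with rows (a , 1) and (1 , 0). Since these matrices are
-- symmetric, reversing a sequence transposes its product A, so the palindrome
-- gives the entry (1 , 0) · Aᵀ A (1 , 0), the squared norm of the first
-- column of A.

open import Defs
open import Data.Irrelevant using ([_])
open import Data.List using (List; []; _∷_; _++_; concatMap; deduplicate; filter; foldl; foldr; length; map; replicate; reverse)
open import Data.List.Membership.Propositional using (_∈_; _∉_)
open import Data.List.Membership.Propositional.Properties
  using (∈-++⁺ˡ; ∈-++⁺ʳ; ∈-++⁻; ∈-concatMap⁺; ∈-concatMap⁻; ∈-deduplicate⁺; ∈-deduplicate⁻)
open import Data.List.Membership.Propositional.Properties.WithK using (unique∧set⇒bag)
open import Data.List.Properties using (∷-injectiveˡ; filter-++; filter-accept; filter-none; filter-reject; foldr-++; length-++; reverse-foldr)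
open import Data.List.Relation.Binary.BagAndSetEquality using (∼bag⇒↭)
open import Data.List.Relation.Binary.Permutation.Propositional using (_↭_; module _↭_; prep; swap; ↭-refl; ↭-sym)
open import Data.List.Relation.Binary.Permutation.Propositional.Properties using (filter-↭; ↭-length)
open import Data.List.Relation.Binary.Subset.Propositional using (_⊆_)
open import Data.List.Relation.Binary.Subset.Propositional.Properties using (∷⁺ʳ; ⊆-refl)
open import Data.List.Relation.Unary.All as All using (All; []; _∷_)
open import Data.List.Relation.Unary.AllPairs as AllPairs using ()
open import Data.List.Relation.Unary.Any as Any using (here; there)
open import Data.List.Relation.Unary.Unique.DecPropositional.Properties using (deduplicate-!)
open import Data.List.Relation.Unary.Unique.Propositional using (Unique)
open import Data.Nat using (ℕ; zero; suc; _+_; _*_; _^_; _≤_)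
open import Data.Nat.Properties using (*-identityˡ; *-identityʳ; +-assoc; +-comm; +-identityʳ; 1+n≰n; ≤-refl; ≤-trans; n≤1+n)
open import Data.Nat.Tactic.RingSolver using (solve-∀)
open import Data.Product using (_×_; _,_; proj₁; proj₂)
open import Data.Refinement using (value; _,_)
open import Data.Sign using (Sign; opposite) renaming (+ to plus; - to minus)
open import Data.Sign.Properties using (opposite-involutive)
open import Data.Sum using ([_,_]′; inj₁; inj₂)
open import Function using (_∘_; flip; _⇔_; mk⇔; Equivalence)
open import Relation.Binary.Definitions using (DecidableEquality)
open import Relation.Binary.PropositionalEquality using (_≡_; _≢_; refl; cong; cong₂; sym; trans; subst; module ≡-Reasoning)
open import Relation.Nullary using (¬_; Dec; yes; no; contradiction)
open import Relation.Unary using (Decidable)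

-- Counting sublists with a decidable property

length-filter-map : ∀ {A B : Set} {P : B → Set} (P? : Decidable P) (f : A → B) xs →
                    length (filter P? (map f xs)) ≡ length (filter (P? ∘ f) xs)
length-filter-map P? f [] = refl
length-filter-map P? f (x ∷ xs) with P? (f x)
... | yes _ = cong suc (length-filter-map P? f xs)
... | no  _ = length-filter-map P? f xs

module _ {A : Set} where

  count : {P : List A → Set} → Decidable P → List A → ℕ
  count P? E = length (filter P? (subsets E))

  count-∷ : {P : List A → Set} (P? : Decidable P) → ∀ e E →
            count P? (e ∷ E) ≡ count (P? ∘ (e ∷_)) E + count P? E
  count-∷ P? e E = begin
    length (filter P? (map (e ∷_) (subsets E) ++ subsets E))
      ≡⟨ cong length (filter-++ P? (map (e ∷_) (subsets E)) (subsets E)) ⟩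
    length (filter P? (map (e ∷_) (subsets E)) ++ filter P? (subsets E))
      ≡⟨ length-++ (filter P? (map (e ∷_) (subsets E))) ⟩
    length (filter P? (map (e ∷_) (subsets E))) + count P? E
      ≡⟨ cong (_+ count P? E) (length-filter-map P? (e ∷_) (subsets E)) ⟩
    count (P? ∘ (e ∷_)) E + count P? E ∎
    where open ≡-Reasoning

  -- Comparing only lists drawn from `E` lets the equivalence use facts about the edges at hand,
  -- such as which points they avoid.
  count-cong : ∀ {P Q : List A → Set} (P? : Decidable P) (Q? : Decidable Q) E →
               (∀ {M} → M ⊆ E → P M ⇔ Q M) → count P? E ≡ count Q? E
  count-cong P? Q? [] P⇔Q with P? [] | Q? []
  ... | yes _ | yes _ = refl
  ... | no  _ | no  _ = refl
  ... | yes p | no ¬q = contradiction (Equivalence.to (P⇔Q ⊆-refl) p) ¬q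
  ... | no ¬p | yes q = contradiction (Equivalence.from (P⇔Q ⊆-refl) q) ¬p
  count-cong P? Q? (e ∷ E) P⇔Q = begin
    count P? (e ∷ E)                     ≡⟨ count-∷ P? e E ⟩
    count (P? ∘ (e ∷_)) E + count P? E
      ≡⟨ cong₂ _+_ (count-cong (P? ∘ (e ∷_)) (Q? ∘ (e ∷_)) E (λ M⊆E → P⇔Q (∷⁺ʳ e M⊆E)))
                   (count-cong P? Q? E (λ M⊆E → P⇔Q (there ∘ M⊆E))) ⟩
    count (Q? ∘ (e ∷_)) E + count Q? E   ≡⟨ sym (count-∷ Q? e E) ⟩
    count Q? (e ∷ E)                     ∎
    where open ≡-Reasoning

  count-none : ∀ {P : List A → Set} (P? : Decidable P) E → (∀ {M} → M ⊆ E → ¬ P M) → count P? E ≡ 0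
  count-none P? [] ¬P with P? []
  ... | yes p = contradiction p (¬P ⊆-refl)
  ... | no  _ = refl
  count-none P? (e ∷ E) ¬P = trans (count-∷ P? e E)
    (cong₂ _+_ (count-none (P? ∘ (e ∷_)) E (λ M⊆E → ¬P (∷⁺ʳ e M⊆E)))
               (count-none P? E (λ M⊆E → ¬P (there ∘ M⊆E))))

  -- Meant for an edge that would cover some vertex a second time.
  count-skip : ∀ {P : List A → Set} (P? : Decidable P) e E →
               (∀ {M} → M ⊆ E → ¬ P (e ∷ M)) → count P? (e ∷ E) ≡ count P? E
  count-skip P? e E ¬P = trans (count-∷ P? e E) (cong (_+ count P? E) (count-none (P? ∘ (e ∷_)) E ¬P))

  -- Meant for a forced edge: the only one left in the list that can cover some vertex.
  count-take : ∀ {P : List A → Set} (P? : Decidable P) e E →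
               (∀ {M} → M ⊆ E → ¬ P M) → count P? (e ∷ E) ≡ count (P? ∘ (e ∷_)) E
  count-take P? e E ¬P = begin
    count P? (e ∷ E)                     ≡⟨ count-∷ P? e E ⟩
    count (P? ∘ (e ∷_)) E + count P? E   ≡⟨ cong (count (P? ∘ (e ∷_)) E +_) (count-none P? E ¬P) ⟩
    count (P? ∘ (e ∷_)) E + 0            ≡⟨ +-identityʳ _ ⟩
    count (P? ∘ (e ∷_)) E                ∎
    where open ≡-Reasoning

  -- Permuting `E` also reorders the sublists themselves, so `P` has to be invariant under
  -- permutation. In the swap case the count splits into four by the presence of `e` and `e′`; only
  -- the sublists with both change their order.
  count-↭ : ∀ {P : List A → Set} (P? : Decidable P) → (∀ {M N} → M ↭ N → P M → P N) →
            ∀ {E E′} → E ↭ E′ → count P? E ≡ count P? E′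
  count-↭ P? resp _↭_.refl = refl
  count-↭ P? resp (_↭_.trans p q) = trans (count-↭ P? resp p) (count-↭ P? resp q)
  count-↭ P? resp {e ∷ E} {_ ∷ E′} (prep _ p) = begin
    count P? (e ∷ E)                     ≡⟨ count-∷ P? e E ⟩
    count (P? ∘ (e ∷_)) E + count P? E
      ≡⟨ cong₂ _+_ (count-↭ (P? ∘ (e ∷_)) (resp ∘ prep e) p) (count-↭ P? resp p) ⟩
    count (P? ∘ (e ∷_)) E′ + count P? E′ ≡⟨ sym (count-∷ P? e E′) ⟩
    count P? (e ∷ E′)                    ∎
    where open ≡-Reasoning
  count-↭ P? resp {_ ∷ _ ∷ E} {_ ∷ _ ∷ E′} (swap e e′ p) = begin
    count P? (e ∷ e′ ∷ E)
      ≡⟨ expand e e′ E ⟩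
    (count (P? ∘ (e ∷_) ∘ (e′ ∷_)) E + count (P? ∘ (e ∷_)) E) + (count (P? ∘ (e′ ∷_)) E + count P? E)
      ≡⟨ interchange (count (P? ∘ (e ∷_) ∘ (e′ ∷_)) E) _ _ _ ⟩
    (count (P? ∘ (e ∷_) ∘ (e′ ∷_)) E + count (P? ∘ (e′ ∷_)) E) + (count (P? ∘ (e ∷_)) E + count P? E)
      ≡⟨ cong₂ _+_
           (cong₂ _+_
             (trans (count-cong (P? ∘ (e ∷_) ∘ (e′ ∷_)) (P? ∘ (e′ ∷_) ∘ (e ∷_)) E
                        (λ _ → mk⇔ (resp (swap e e′ ↭-refl)) (resp (swap e′ e ↭-refl))))
                      (count-↭ (P? ∘ (e′ ∷_) ∘ (e ∷_)) (λ q → resp (prep e′ (prep e q))) p))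
             (count-↭ (P? ∘ (e′ ∷_)) (resp ∘ prep e′) p))
           (cong₂ _+_ (count-↭ (P? ∘ (e ∷_)) (resp ∘ prep e) p) (count-↭ P? resp p)) ⟩
    (count (P? ∘ (e′ ∷_) ∘ (e ∷_)) E′ + count (P? ∘ (e′ ∷_)) E′) + (count (P? ∘ (e ∷_)) E′ + count P? E′)
      ≡⟨ sym (expand e′ e E′) ⟩
    count P? (e′ ∷ e ∷ E′) ∎
    where
    open ≡-Reasoning
    expand : ∀ e e′ E → count P? (e ∷ e′ ∷ E) ≡
             (count (P? ∘ (e ∷_) ∘ (e′ ∷_)) E + count (P? ∘ (e ∷_)) E) + (count (P? ∘ (e′ ∷_)) E + count P? E)
    expand e e′ E = trans (count-∷ P? e (e′ ∷ E)) (cong₂ _+_ (count-∷ (P? ∘ (e ∷_)) e′ E) (count-∷ P? e′ E))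
    interchange : ∀ a b c d → (a + b) + (c + d) ≡ (a + c) + (b + d)
    interchange = solve-∀

-- Vertex degrees in an edge list

degree-hit : ∀ {v} e M → Incident v e → degree (e ∷ M) v ≡ suc (degree M v)
degree-hit {v} e M i = cong length (filter-accept (incident? v) {x = e} {xs = M} i)

degree-miss : ∀ {v} e M → ¬ Incident v e → degree (e ∷ M) v ≡ degree M v
degree-miss {v} e M ¬i = cong length (filter-reject (incident? v) {x = e} {xs = M} ¬i)

degree-none : ∀ {v} M → (∀ {e} → e ∈ M → ¬ Incident v e) → degree M v ≡ 0
degree-none {v} M ¬i = cong length (filter-none (incident? v) (All.tabulate {xs = M} ¬i))

degree-double : ∀ {v} e e′ M → Incident v e → Incident v e′ → degree (e ∷ e′ ∷ M) v ≢ 1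
degree-double e e′ M i i′ d
  with () ← trans (sym (trans (degree-hit e (e′ ∷ M) i) (cong suc (degree-hit e′ M i′)))) d

degree-↭ : ∀ {v M N} → M ↭ N → degree M v ≡ degree N v
degree-↭ {v} p = ↭-length (filter-↭ (incident? v) p)

isPerfect-↭ : ∀ H {M N} → M ↭ N → IsPerfect H M → IsPerfect H N
isPerfect-↭ H p = All.map (trans (degree-↭ (↭-sym p)))

not-incident : ∀ {v p q} → v ≢ p → v ≢ q → ¬ Incident v (p , q)
not-incident v≢p v≢q (inj₁ eq) = v≢p eq
not-incident v≢p v≢q (inj₂ eq) = v≢q eq

-- Perfect matchings after gluing on a square

-- For e ∈ edges H this is the number of perfect matchings of H containing
-- e: a perfect matching e ∷ M cannot contain e twice.
matchingsWith : Edge → Graph → ℕ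
matchingsWith e H = count (λ M → isPerfect? H (e ∷ M)) (edges H)

-- H arises from R by gluing the square p q r′ r along its side r r′.
record Attached (H R : Graph) (p q r r′ : Point) : Set where
  field
    vertices⇔ : ∀ {v} → v ∈ vertices H ⇔ v ∈ p ∷ q ∷ vertices R
    edges↭    : edges H ↭ (p , r) ∷ (p , q) ∷ (q , r′) ∷ edges R
    closed    : ∀ {e v} → e ∈ edges R → Incident v e → v ∈ vertices R
    p∉        : p ∉ vertices R
    q∉        : q ∉ vertices R
    r∈        : r ∈ vertices R
    r′∈       : r′ ∈ vertices R
    p≢q       : p ≢ q
    r≢r′      : r ≢ r′

module _ {H R p q r r′} (a : Attached H R p q r r′) where
  open Attached a

  private
    p≢ : ∀ {v} → v ∈ vertices R → p ≢ v
    p≢ v∈ eq = p∉ (subst (_∈ vertices R) (sym eq) v∈)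

    q≢ : ∀ {v} → v ∈ vertices R → q ≢ v
    q≢ v∈ eq = q∉ (subst (_∈ vertices R) (sym eq) v∈)

    degree-p : ∀ {M} → M ⊆ edges R → degree M p ≡ 0
    degree-p {M} M⊆ = degree-none M (λ e∈ i → p∉ (closed (M⊆ e∈) i))

    degree-q : ∀ {M} → M ⊆ edges R → degree M q ≡ 0
    degree-q {M} M⊆ = degree-none M (λ e∈ i → q∉ (closed (M⊆ e∈) i))

    at-p : ∀ N → IsPerfect H N → degree N p ≡ 1
    at-p N ds = All.lookup {P = λ v → degree N v ≡ 1} ds (Equivalence.from vertices⇔ (here refl))

    at-q : ∀ N → IsPerfect H N → degree N q ≡ 1
    at-q N ds = All.lookup {P = λ v → degree N v ≡ 1} ds (Equivalence.from vertices⇔ (there (here refl)))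

    -- The only vertices of `H` outside `R` are `p` and `q`; once these are covered exactly once,
    -- only the degrees on `R` have to be compared.
    restrict : ∀ N N′ → degree N p ≡ 1 → degree N q ≡ 1 →
               (∀ {v} → v ∈ vertices R → degree N v ≡ degree N′ v) → IsPerfect H N ⇔ IsPerfect R N′
    restrict N N′ dp dq eq = mk⇔
      (λ ds → All.tabulate (λ v∈ → trans (sym (eq v∈))
        (All.lookup {P = λ v → degree N v ≡ 1} ds (Equivalence.from vertices⇔ (there (there v∈))))))
      (λ ds → All.tabulate (extend ds ∘ Equivalence.to vertices⇔))
      where
      extend : IsPerfect R N′ → ∀ {v} → v ∈ p ∷ q ∷ vertices R → degree N v ≡ 1
      extend ds (here refl)         = dp
      extend ds (there (here refl)) = dq
      extend ds (there (there v∈))  = trans (eq v∈) (All.lookup {P = λ v → degree N′ v ≡ 1} ds v∈)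

    extends? : (e : Edge) → Decidable (λ M → IsPerfect H (e ∷ M))
    extends? e M = isPerfect? H (e ∷ M)

    pr pq qr′ rr′ : Edge
    pr  = p , r
    pq  = p , q
    qr′ = q , r′
    rr′ = r , r′

    p≁qr′ : ¬ Incident p qr′
    p≁qr′ = not-incident p≢q (p≢ r′∈)

    q≁pr : ¬ Incident q pr
    q≁pr = not-incident (p≢q ∘ sym) (q≢ r∈)

    -- The edge `pq` already covers `q`, which rules out `qr′`; it touches no vertex of `R`, so the
    -- rest is any perfect matching of `R`.
    with-pq : count (extends? pq) (qr′ ∷ edges R) ≡ m R
    with-pq = trans
      (count-skip (extends? pq) qr′ (edges R)
        (λ {M} _ ds → degree-double pq qr′ M (inj₂ refl) (inj₁ refl) (at-q (pq ∷ qr′ ∷ M) ds)))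
      (count-cong (extends? pq) (isPerfect? R) (edges R) (λ {M} M⊆ → restrict (pq ∷ M) M
        (trans (degree-hit pq M (inj₁ refl)) (cong suc (degree-p M⊆)))
        (trans (degree-hit pq M (inj₂ refl)) (cong suc (degree-q M⊆)))
        (λ v∈ → degree-miss pq M (not-incident (p≢ v∈ ∘ sym) (q≢ v∈ ∘ sym)))))

    -- With `pr` chosen, `q` can only be covered by `qr′`. On the vertices of `R` these two edges
    -- together have the same degrees as the single edge `rr′`.
    with-pr : count (extends? pr) (qr′ ∷ edges R) ≡ matchingsWith rr′ R
    with-pr = trans
      (count-take (extends? pr) qr′ (edges R) uncovered)
      (count-cong (extends? pr ∘ (qr′ ∷_)) (λ M → isPerfect? R (rr′ ∷ M)) (edges R)
        (λ {M} M⊆ → restrict (pr ∷ qr′ ∷ M) (rr′ ∷ M)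
          (trans (degree-hit pr (qr′ ∷ M) (inj₁ refl))
            (cong suc (trans (degree-miss qr′ M p≁qr′) (degree-p M⊆))))
          (trans (degree-miss pr (qr′ ∷ M) q≁pr)
            (trans (degree-hit qr′ M (inj₁ refl)) (cong suc (degree-q M⊆))))
          (same M)))
      where
      uncovered : ∀ {M} → M ⊆ edges R → ¬ IsPerfect H (pr ∷ M)
      uncovered {M} M⊆ ds
        with () ← trans (sym (trans (degree-miss pr M q≁pr) (degree-q M⊆))) (at-q (pr ∷ M) ds)

      same : ∀ M {v} → v ∈ vertices R → degree (pr ∷ qr′ ∷ M) v ≡ degree (rr′ ∷ M) v
      same M {v} v∈ = compare (v ≟ᵖ r) (v ≟ᵖ r′)
        where
        compare : Dec (v ≡ r) → Dec (v ≡ r′) → degree (pr ∷ qr′ ∷ M) v ≡ degree (rr′ ∷ M) v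
        compare (yes refl) _ = trans (degree-hit pr (qr′ ∷ M) (inj₂ refl))
          (trans (cong suc (degree-miss qr′ M (not-incident (q≢ v∈ ∘ sym) r≢r′)))
            (sym (degree-hit rr′ M (inj₁ refl))))
        compare (no v≢r) (yes refl) = trans (degree-miss pr (qr′ ∷ M) (not-incident (p≢ v∈ ∘ sym) v≢r))
          (trans (degree-hit qr′ M (inj₂ refl)) (sym (degree-hit rr′ M (inj₂ refl))))
        compare (no v≢r) (no v≢r′) = trans (degree-miss pr (qr′ ∷ M) (not-incident (p≢ v∈ ∘ sym) v≢r))
          (trans (degree-miss qr′ M (not-incident (q≢ v∈ ∘ sym) v≢r′))
            (sym (degree-miss rr′ M (not-incident v≢r v≢r′))))

    skip-at-p : ∀ e e′ E → Incident p e → Incident p e′ → count (extends? e) (e′ ∷ E) ≡ count (extends? e) E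
    skip-at-p e e′ E i i′ = count-skip (extends? e) e′ E
      (λ {M} _ ds → degree-double e e′ M i i′ (at-p (e ∷ e′ ∷ M) ds))

    -- Both `pr` and `pq` drop out of the list, including a second copy of `e` itself, since either
    -- would cover `p` twice.
    matchingsWith-at-p : ∀ e → Incident p e → matchingsWith e H ≡ count (extends? e) (qr′ ∷ edges R)
    matchingsWith-at-p e i = trans
      (count-↭ (extends? e) (λ M↭N → isPerfect-↭ H (prep e M↭N)) edges↭)
      (trans (skip-at-p e pr (pq ∷ qr′ ∷ edges R) i (inj₁ refl)) (skip-at-p e pq (qr′ ∷ edges R) i (inj₁ refl)))

  matchingsWith-pq : matchingsWith (p , q) H ≡ m R
  matchingsWith-pq = trans (matchingsWith-at-p pq (inj₁ refl)) with-pq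

  matchingsWith-pr : matchingsWith (p , r) H ≡ matchingsWith (r , r′) R
  matchingsWith-pr = trans (matchingsWith-at-p pr (inj₁ refl)) with-pr

  -- The vertex `p` lies on no edges other than `pr` and `pq`, and a perfect matching uses exactly
  -- one of them.
  m-attached : m H ≡ matchingsWith (p , r) H + matchingsWith (p , q) H
  m-attached = begin
    m H
      ≡⟨ count-↭ (isPerfect? H) (isPerfect-↭ H) edges↭ ⟩
    count (isPerfect? H) (pr ∷ pq ∷ qr′ ∷ edges R)
      ≡⟨ count-∷ (isPerfect? H) pr (pq ∷ qr′ ∷ edges R) ⟩
    count (extends? pr) (pq ∷ qr′ ∷ edges R) + count (isPerfect? H) (pq ∷ qr′ ∷ edges R)
      ≡⟨ cong₂ _+_ (skip-at-p pr pq (qr′ ∷ edges R) (inj₁ refl) (inj₁ refl))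
                   (count-take (isPerfect? H) pq (qr′ ∷ edges R) uncovered) ⟩
    count (extends? pr) (qr′ ∷ edges R) + count (extends? pq) (qr′ ∷ edges R)
      ≡⟨ sym (cong₂ _+_ (matchingsWith-at-p pr (inj₁ refl)) (matchingsWith-at-p pq (inj₁ refl))) ⟩
    matchingsWith pr H + matchingsWith pq H ∎
    where
    open ≡-Reasoning
    avoid : ∀ {e} → e ∈ qr′ ∷ edges R → ¬ Incident p e
    avoid (here refl) = p≁qr′
    avoid (there e∈)  = p∉ ∘ closed e∈
    uncovered : ∀ {M} → M ⊆ qr′ ∷ edges R → ¬ IsPerfect H M
    uncovered {M} M⊆ ds with () ← trans (sym (degree-none M (avoid ∘ M⊆))) (at-p M ds)

-- Snake graphs as squares glued on one by one

deduplicate-++-⇔ : ∀ {A : Set} (_≟_ : DecidableEquality A) {xs ys ws zs : List A} →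
                   All (_∈ ys ++ zs) xs → All (_∈ xs) ys → ws ⊆ zs → zs ⊆ xs ++ ws →
                   ∀ {v} → v ∈ deduplicate _≟_ (xs ++ ws) ⇔ v ∈ ys ++ zs
deduplicate-++-⇔ _≟_ {xs} {ys} {ws} {zs} xs⊆ ys⊆ ws⊆ zs⊆ = mk⇔
  ([ All.lookup xs⊆ , ∈-++⁺ʳ ys ∘ ws⊆ ]′ ∘ ∈-++⁻ xs ∘ ∈-deduplicate⁻ _≟_ (xs ++ ws))
  (∈-deduplicate⁺ _≟_ ∘ [ ∈-++⁺ˡ ∘ All.lookup ys⊆ , zs⊆ ]′ ∘ ∈-++⁻ ys)

-- Membership checks suffice: vertices matter only as a set, and for edges the absence of
-- repetitions on both sides turns equality of sets into a permutation. Here `cs` and `ss` come from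
-- the first tile, `vs` and `es` from the remaining ones.
attach : ∀ {R p q r r′} cs vs ss es →
         All (_∈ p ∷ q ∷ vertices R) cs → All (_∈ cs) (p ∷ q ∷ []) →
         vs ⊆ vertices R → vertices R ⊆ cs ++ vs →
         All (_∈ (p , r) ∷ (p , q) ∷ (q , r′) ∷ edges R) ss →
         All (_∈ ss) ((p , r) ∷ (p , q) ∷ (q , r′) ∷ []) →
         es ⊆ edges R → edges R ⊆ ss ++ es →
         Unique (edges R) → (∀ {e v} → e ∈ edges R → Incident v e → v ∈ vertices R) →
         p ∉ vertices R → q ∉ vertices R → r ∈ vertices R → r′ ∈ vertices R → p ≢ q → r ≢ r′ →
         Attached (mkGraph (deduplicate _≟ᵖ_ (cs ++ vs)) (deduplicate _≟ᵉ_ (ss ++ es))) R p q r r′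
attach {R} {p} {q} {r} {r′} cs vs ss es cs⊆ pq⊆ vs⊆ V⊆ ss⊆ new⊆ es⊆ E⊆ unique closed p∉ q∉ r∈ r′∈ p≢q r≢r′ = record
  { vertices⇔ = deduplicate-++-⇔ _≟ᵖ_ {ys = p ∷ q ∷ []} cs⊆ pq⊆ vs⊆ V⊆
  ; edges↭    = ∼bag⇒↭ (unique∧set⇒bag (deduplicate-! _≟ᵉ_ (ss ++ es)) unique′
                  (deduplicate-++-⇔ _≟ᵉ_ {ys = (p , r) ∷ (p , q) ∷ (q , r′) ∷ []} ss⊆ new⊆ es⊆ E⊆))
  ; closed    = closed
  ; p∉        = p∉
  ; q∉        = q∉
  ; r∈        = r∈
  ; r′∈       = r′∈
  ; p≢q       = p≢q
  ; r≢r′      = r≢r′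
  }
  where
  fresh : ∀ {v e} → Incident v e → v ∉ vertices R → All (e ≢_) (edges R)
  fresh i v∉ = All.tabulate λ { e∈ refl → v∉ (closed e∈ i) }

  unique′ : Unique ((p , r) ∷ (p , q) ∷ (q , r′) ∷ edges R)
  unique′ = ((λ { refl → q∉ r∈ }) ∷ (λ { refl → p≢q refl }) ∷ fresh (inj₁ refl) p∉)
    AllPairs.∷ ((λ { refl → p≢q refl }) ∷ fresh (inj₁ refl) p∉)
    AllPairs.∷ fresh (inj₁ refl) q∉
    AllPairs.∷ unique

-- The first tile is a parameter because the induction removes tiles from the start; at `origin`
-- this is `snakeGraph` by definition.
snakeFrom : Tile → List Step → Graph
snakeFrom G ts = mkGraph
  (deduplicate _≟ᵖ_ (concatMap corners (tilesFrom G ts)))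
  (deduplicate _≟ᵉ_ (concatMap sides (tilesFrom G ts)))

first-tile⊆ : ∀ {A : Set} (g : Tile → List A) G ts → g G ⊆ concatMap g (tilesFrom G ts)
first-tile⊆ g G []      = ∈-++⁺ˡ
first-tile⊆ g G (_ ∷ _) = ∈-++⁺ˡ

corners⊆ : ∀ {G} ts → corners G ⊆ vertices (snakeFrom G ts)
corners⊆ {G} ts v∈ = ∈-deduplicate⁺ _≟ᵖ_ {xs = concatMap corners (tilesFrom G ts)} (first-tile⊆ corners G ts v∈)

sides⊆ : ∀ {G} ts → sides G ⊆ edges (snakeFrom G ts)
sides⊆ {G} ts e∈ = ∈-deduplicate⁺ _≟ᵉ_ {xs = concatMap sides (tilesFrom G ts)} (first-tile⊆ sides G ts e∈)

sides-closed : ∀ {G e v} → e ∈ sides G → Incident v e → v ∈ corners G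
sides-closed (here refl)                         (inj₁ refl) = here refl
sides-closed (here refl)                         (inj₂ refl) = there (here refl)
sides-closed (there (here refl))                 (inj₁ refl) = here refl
sides-closed (there (here refl))                 (inj₂ refl) = there (there (here refl))
sides-closed (there (there (here refl)))         (inj₁ refl) = there (there (here refl))
sides-closed (there (there (here refl)))         (inj₂ refl) = there (there (there (here refl)))
sides-closed (there (there (there (here refl)))) (inj₁ refl) = there (here refl)
sides-closed (there (there (there (here refl)))) (inj₂ refl) = there (there (there (here refl)))

snake-closed : ∀ {G e v} ts → e ∈ edges (snakeFrom G ts) → Incident v e → v ∈ vertices (snakeFrom G ts)
snake-closed {G} ts e∈ i = ∈-deduplicate⁺ _≟ᵖ_ (∈-concatMap⁺ corners
  (Any.map (λ e∈G → sides-closed e∈G i)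
    (∈-concatMap⁻ sides {xs = tilesFrom G ts} (∈-deduplicate⁻ _≟ᵉ_ _ e∈))))

infix 4 _⊑_
-- Steps only go right or up, so the rest of a snake lies weakly to the upper right of its own first
-- tile. This shows that the corners `p` and `q` of the preceding tile are new.
_⊑_ : Point → Point → Set
(x , y) ⊑ (x′ , y′) = x ≤ x′ × y ≤ y′

⊑-translate : ∀ t {G v} → translate t G ⊑ v → G ⊑ v
⊑-translate rightward (x≤ , y≤) = ≤-trans (n≤1+n _) x≤ , y≤
⊑-translate upward    (x≤ , y≤) = x≤ , ≤-trans (n≤1+n _) y≤

corners-⊒ : ∀ {G v} → v ∈ corners G → G ⊑ v
corners-⊒ (here refl)                         = ≤-refl , ≤-refl
corners-⊒ (there (here refl))                 = n≤1+n _ , ≤-refl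
corners-⊒ (there (there (here refl)))         = ≤-refl , n≤1+n _
corners-⊒ (there (there (there (here refl)))) = n≤1+n _ , n≤1+n _

tiles-⊒ : ∀ G ts {v} → v ∈ concatMap corners (tilesFrom G ts) → G ⊑ v
tiles-⊒ G []       v∈ = [ corners-⊒ , (λ ()) ]′ (∈-++⁻ (corners G) v∈)
tiles-⊒ G (t ∷ ts) v∈ = [ corners-⊒ , ⊑-translate t ∘ tiles-⊒ (translate t G) ts ]′ (∈-++⁻ (corners G) v∈)

snake-⊒ : ∀ {G} ts {v} → v ∈ vertices (snakeFrom G ts) → G ⊑ v
snake-⊒ {G} ts v∈ = tiles-⊒ G ts (∈-deduplicate⁻ _≟ᵖ_ _ v∈)

snake-unique : ∀ {G} ts → Unique (edges (snakeFrom G ts))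
snake-unique ts = deduplicate-! _≟ᵉ_ _

segment : Point → Point → Graph
segment r r′ = mkGraph (r ∷ r′ ∷ []) ((r , r′) ∷ [])

-- A single tile counts as a square glued onto its own east edge, which replaces the rest of the
-- snake in the base case.
attach-segment : ∀ x y → Attached (snakeFrom (x , y) []) (segment (suc x , y) (suc x , suc y))
                                  (x , y) (x , suc y) (suc x , y) (suc x , suc y)
attach-segment x y = attach (corners (x , y)) [] (sides (x , y)) []
  (here refl ∷ there (there (here refl)) ∷ there (here refl) ∷ there (there (there (here refl))) ∷ [])
  (here refl ∷ there (there (here refl)) ∷ [])
  (λ ())
  (λ { (here refl) → there (here refl) ; (there (here refl)) → there (there (there (here refl))) })
  (here refl ∷ there (here refl) ∷ there (there (here refl)) ∷ there (there (there (here refl))) ∷ [])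
  (here refl ∷ there (here refl) ∷ there (there (here refl)) ∷ [])
  (λ ())
  (λ { (here refl) → there (there (there (here refl))) })
  ([] AllPairs.∷ AllPairs.[])
  (λ { (here refl) (inj₁ refl) → here refl ; (here refl) (inj₂ refl) → there (here refl) })
  (λ { (here ()) ; (there (here ())) })
  (λ { (here ()) ; (there (here ())) })
  (here refl) (there (here refl)) (λ ()) (λ ())

attach-rightward : ∀ x y ts → Attached (snakeFrom (x , y) (rightward ∷ ts)) (snakeFrom (suc x , y) ts)
                                       (x , y) (x , suc y) (suc x , y) (suc x , suc y)
attach-rightward x y ts = attach
  (corners (x , y)) (concatMap corners (tilesFrom (suc x , y) ts))
  (sides (x , y)) (concatMap sides (tilesFrom (suc x , y) ts))
  (here refl ∷ there (there r∈) ∷ there (here refl) ∷ there (there r′∈) ∷ [])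
  (here refl ∷ there (there (here refl)) ∷ [])
  (∈-deduplicate⁺ _≟ᵖ_)
  (∈-++⁺ʳ (corners (x , y)) ∘ ∈-deduplicate⁻ _≟ᵖ_ _)
  (here refl ∷ there (here refl) ∷ there (there (here refl)) ∷ there (there (there (sides⊆ ts (there (here refl))))) ∷ [])
  (here refl ∷ there (here refl) ∷ there (there (here refl)) ∷ [])
  (∈-deduplicate⁺ _≟ᵉ_)
  (∈-++⁺ʳ (sides (x , y)) ∘ ∈-deduplicate⁻ _≟ᵉ_ _)
  (snake-unique ts) (snake-closed ts)
  (1+n≰n ∘ proj₁ ∘ snake-⊒ ts) (1+n≰n ∘ proj₁ ∘ snake-⊒ ts)
  r∈ r′∈ (λ ()) (λ ())
  where
  r∈  = corners⊆ ts (here refl)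
  r′∈ = corners⊆ ts (there (there (here refl)))

-- The shared edge is now the north one, so `(p , q)` is the south edge and `(p , r)` the west edge;
-- in the rightward case these roles are exchanged.
attach-upward : ∀ x y ts → Attached (snakeFrom (x , y) (upward ∷ ts)) (snakeFrom (x , suc y) ts)
                                    (x , y) (suc x , y) (x , suc y) (suc x , suc y)
attach-upward x y ts = attach
  (corners (x , y)) (concatMap corners (tilesFrom (x , suc y) ts))
  (sides (x , y)) (concatMap sides (tilesFrom (x , suc y) ts))
  (here refl ∷ there (here refl) ∷ there (there r∈) ∷ there (there r′∈) ∷ [])
  (here refl ∷ there (here refl) ∷ [])
  (∈-deduplicate⁺ _≟ᵖ_)
  (∈-++⁺ʳ (corners (x , y)) ∘ ∈-deduplicate⁻ _≟ᵖ_ _)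
  (there (here refl) ∷ here refl ∷ there (there (there (sides⊆ ts (here refl)))) ∷ there (there (here refl)) ∷ [])
  (there (here refl) ∷ here refl ∷ there (there (there (here refl))) ∷ [])
  (∈-deduplicate⁺ _≟ᵉ_)
  (∈-++⁺ʳ (sides (x , y)) ∘ ∈-deduplicate⁻ _≟ᵉ_ _)
  (snake-unique ts) (snake-closed ts)
  (1+n≰n ∘ proj₂ ∘ snake-⊒ ts) (1+n≰n ∘ proj₂ ∘ snake-⊒ ts)
  r∈ r′∈ (λ ()) (λ ())
  where
  r∈  = corners⊆ ts (here refl)
  r′∈ = corners⊆ ts (there (here refl))

-- Matchings of a single edge, and the split at the first tile

count-[] : ∀ {A : Set} {P : List A → Set} (P? : Decidable P) → P [] → count P? [] ≡ 1
count-[] P? p = cong length (filter-accept P? p)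

segment-perfect : ∀ r r′ → IsPerfect (segment r r′) ((r , r′) ∷ [])
segment-perfect r r′ = degree-hit (r , r′) [] (inj₁ refl) ∷ degree-hit (r , r′) [] (inj₂ refl) ∷ []

matchingsWith-segment : ∀ r r′ → matchingsWith (r , r′) (segment r r′) ≡ 1
matchingsWith-segment r r′ = trans
  (count-skip (λ M → isPerfect? (segment r r′) ((r , r′) ∷ M)) (r , r′) []
    (λ { {M} _ (d ∷ _) → degree-double (r , r′) (r , r′) M (inj₁ refl) (inj₁ refl) d }))
  (count-[] (λ M → isPerfect? (segment r r′) ((r , r′) ∷ M)) (segment-perfect r r′))

m-segment : ∀ r r′ → m (segment r r′) ≡ 1
m-segment r r′ = trans
  (count-take (isPerfect? (segment r r′)) (r , r′) [] uncovered)
  (count-[] (λ M → isPerfect? (segment r r′) ((r , r′) ∷ M)) (segment-perfect r r′))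
  where
  uncovered : ∀ {M} → M ⊆ [] → ¬ IsPerfect (segment r r′) M
  uncovered {[]}    _  (() ∷ _)
  uncovered {e ∷ M} M⊆ _ with () ← M⊆ (here refl)

m-snakeFrom : ∀ G ts → m (snakeFrom G ts) ≡
              matchingsWith (south G) (snakeFrom G ts) + matchingsWith (west G) (snakeFrom G ts)
m-snakeFrom (x , y) []               = m-attached (attach-segment x y)
m-snakeFrom (x , y) (rightward ∷ ts) = m-attached (attach-rightward x y ts)
m-snakeFrom (x , y) (upward ∷ ts)    = trans (m-attached (attach-upward x y ts))
  (+-comm (matchingsWith (west (x , y)) H) (matchingsWith (south (x , y)) H))
  where H = snakeFrom (x , y) (upward ∷ ts)

-- Matching counts indexed by signs

-- In the recursion along a snake, `c` belongs to the snake without its first tile, and `τ` is the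
-- sign of the edge shared with it.
advance : Sign → (Sign → ℕ) → Sign → ℕ
advance plus  c plus  = c plus
advance plus  c minus = c plus + c minus
advance minus c plus  = c plus + c minus
advance minus c minus = c minus

advance-same : ∀ τ c → advance τ c τ ≡ c τ
advance-same plus  c = refl
advance-same minus c = refl

advance-opposite : ∀ τ c → advance τ c (opposite τ) ≡ c plus + c minus
advance-opposite plus  c = refl
advance-opposite minus c = refl

sum-signs : ∀ σ (c : Sign → ℕ) → c σ + c (opposite σ) ≡ c plus + c minus
sum-signs plus  c = refl
sum-signs minus c = +-comm (c minus) (c plus)

-- If τs are the signs of the exits of a snake, profile τs σ counts the
-- perfect matchings containing that edge among the south and west edges
-- of the first tile that has sign σ. The value at [] is junk.
profile : List Sign → Sign → ℕ
profile []               = λ _ → 1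
profile (τ ∷ [])         = λ _ → 1
profile (τ ∷ τs@(_ ∷ _)) = advance τ (profile τs)

-- The list of exits is never empty, but this becomes visible to `profile` only after a case split
-- on the steps.
profile-exits : ∀ f τ G ts last →
                ∀ σ → profile (τ ∷ map f (exits G ts last)) σ ≡ advance τ (profile (map f (exits G ts last))) σ
profile-exits f τ G []      last σ = refl
profile-exits f τ G (_ ∷ _) last σ = refl

west≡-south : ∀ {f G} → Signed f G → f (west G) ≡ opposite (f (south G))
west≡-south s = trans (sym (Signed.north≡west s)) (Signed.north≡-south s)

module _ {f : Edge → Sign} (last : Step) where

  exitProfile : Tile → List Step → Sign → ℕ
  exitProfile G ts = profile (map f (exits G ts last))

  StartCounts : Tile → List Step → Set
  StartCounts G ts =
    matchingsWith (south G) (snakeFrom G ts) ≡ exitProfile G ts (f (south G)) ×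
    matchingsWith (west G)  (snakeFrom G ts) ≡ exitProfile G ts (f (west G))

  m-profile : ∀ {G} ts → Signed f G → StartCounts G ts →
              m (snakeFrom G ts) ≡ exitProfile G ts plus + exitProfile G ts minus
  m-profile {G} ts s (S , W) = begin
    m (snakeFrom G ts)                                        ≡⟨ m-snakeFrom G ts ⟩
    matchingsWith (south G) (snakeFrom G ts) + matchingsWith (west G) (snakeFrom G ts)
      ≡⟨ cong₂ _+_ S W ⟩
    c (f (south G)) + c (f (west G))                          ≡⟨ cong (λ σ → c (f (south G)) + c σ) (west≡-south s) ⟩
    c (f (south G)) + c (opposite (f (south G)))              ≡⟨ sum-signs (f (south G)) c ⟩
    c plus + c minus                                          ∎
    where
    open ≡-Reasoning
    c = exitProfile G ts

  exitProfile-same : ∀ {G} t ts {σ} → σ ≡ f (exit t G) →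
                     exitProfile (translate t G) ts (f (exit t G)) ≡ exitProfile G (t ∷ ts) σ
  exitProfile-same {G} t ts refl = trans
    (sym (advance-same (f (exit t G)) (exitProfile (translate t G) ts)))
    (sym (profile-exits f (f (exit t G)) (translate t G) ts last (f (exit t G))))

  exitProfile-opposite : ∀ {G} t ts {σ} → σ ≡ opposite (f (exit t G)) →
                         exitProfile (translate t G) ts plus + exitProfile (translate t G) ts minus ≡
                         exitProfile G (t ∷ ts) σ
  exitProfile-opposite {G} t ts refl = trans
    (sym (advance-opposite (f (exit t G)) (exitProfile (translate t G) ts)))
    (sym (profile-exits f (f (exit t G)) (translate t G) ts last (opposite (f (exit t G)))))

  -- In both directions `(p , r)` has the sign of the exit and `(p , q)` the opposite sign. The
  -- former inherits the count through the shared edge, which is the west or south edge of the next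
  -- tile; the latter inherits all perfect matchings of the remaining snake.
  startCounts : ∀ G ts → All (Signed f) (tilesFrom G ts) → StartCounts G ts
  startCounts (x , y) [] _ =
    trans (matchingsWith-pr (attach-segment x y)) (matchingsWith-segment (suc x , y) (suc x , suc y)) ,
    trans (matchingsWith-pq (attach-segment x y)) (m-segment (suc x , y) (suc x , suc y))
  startCounts (x , y) (rightward ∷ ts) (s ∷ ss) =
    trans (matchingsWith-pr (attach-rightward x y ts))
      (trans (proj₂ ih) (exitProfile-same rightward ts (Signed.south≡east s))) ,
    trans (matchingsWith-pq (attach-rightward x y ts))
      (trans (m-profile ts (headSigned ts ss) ih)
        (exitProfile-opposite rightward ts
          (trans (west≡-south s) (cong opposite (Signed.south≡east s)))))
    where ih = startCounts (suc x , y) ts ss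
  startCounts (x , y) (upward ∷ ts) (s ∷ ss) =
    trans (matchingsWith-pq (attach-upward x y ts))
      (trans (m-profile ts (headSigned ts ss) ih)
        (exitProfile-opposite upward ts
          (trans (sym (opposite-involutive _)) (cong opposite (sym (Signed.north≡-south s)))))) ,
    trans (matchingsWith-pr (attach-upward x y ts))
      (trans (proj₁ ih) (exitProfile-same upward ts (sym (Signed.north≡west s))))
    where ih = startCounts (x , suc y) ts ss

  -- The sign of the first south edge acts like the exit of one more tile in front: advancing by it
  -- places the sum of both entries at the opposite sign.
  m-snakeGraph : ∀ ts → IsSignFunction ts f →
                 m (snakeGraph ts) ≡ profile (signSequence f ts last) (opposite (f (south origin)))
  m-snakeGraph ts ss = trans (m-profile ts (headSigned ts ss) (startCounts origin ts ss))
    (trans (sym (advance-opposite (f (south origin)) (exitProfile origin ts)))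
      (sym (profile-exits f (f (south origin)) origin ts last (opposite (f (south origin))))))

-- Continuants and blocks of signs

-- Multiplication by the symmetric matrix with rows (a , 1) and (1 , 0).
step : ℕ → ℕ × ℕ → ℕ × ℕ
step a (u , v) = a * u + v , u

-- The continuants of a₁ , … , aₙ and of a₂ , … , aₙ.
continuants : List ℕ⁺ → ℕ × ℕ
continuants = foldr (step ∘ value) (1 , 0)

advance-pair : ∀ s c → _≡_ {A = ℕ × ℕ} (advance s c (opposite s) , advance s c s) (c s + c (opposite s) , c s)
advance-pair s c = cong₂ _,_ (trans (advance-opposite s c) (sym (sum-signs s c))) (advance-same s c)

-- One more sign `s` keeps the entry at `s` and adds it to the other, which raises the block length
-- in `step` by one. At a change of block the two entries exchange their roles, which accounts for
-- the off-diagonal ones of the matrix.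
profile-blocks : ∀ s k as →
  let c = profile (s ∷ replicate k s ++ blocks (opposite s) as) in
  _≡_ {A = ℕ × ℕ} (c (opposite s) , c s) (step (suc k) (continuants as))
-- The counts of a one-tile snake are `(1 , 1)`, which is `step 1 (1 , 0)`.
profile-blocks s zero [] = refl
profile-blocks s zero ((zero , [ () ]) ∷ as)
profile-blocks s zero ((suc j , _) ∷ as) = begin
  (advance s c (opposite s) , advance s c s)
    ≡⟨ advance-pair s c ⟩
  (c s + c (opposite s) , c s)
    ≡⟨ cong (λ σ → c σ + c (opposite s) , c σ) (sym (opposite-involutive s)) ⟩
  (c (opposite (opposite s)) + c (opposite s) , c (opposite (opposite s)))
    ≡⟨ cong (λ (u , v) → u + v , u) (profile-blocks (opposite s) j as) ⟩
  (u + v , u)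
    ≡⟨ cong (λ n → n + v , u) (sym (*-identityˡ u)) ⟩
  step 1 (u , v) ∎
  where
  open ≡-Reasoning
  c = profile (opposite s ∷ replicate j (opposite s) ++ blocks (opposite (opposite s)) as)
  u = proj₁ (step (suc j) (continuants as))
  v = proj₂ (step (suc j) (continuants as))
profile-blocks s (suc k) as = begin
  (advance s c (opposite s) , advance s c s)   ≡⟨ advance-pair s c ⟩
  (c s + c (opposite s) , c s)                 ≡⟨ cong (λ (u , v) → v + u , v) (profile-blocks s k as) ⟩
  (u + (suc k * u + v) , u)                    ≡⟨ cong (_, u) (sym (+-assoc u (suc k * u) v)) ⟩
  step (suc (suc k)) (u , v)                   ∎
  where
  open ≡-Reasoning
  c = profile (s ∷ replicate k s ++ blocks (opposite s) as)
  u = proj₁ (continuants as)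
  v = proj₂ (continuants as)

-- The conventions for the empty sequence and for a single 1 fit in, as both continuants are 1.
m-isSnakeGraphOf : ∀ {as H} → IsSnakeGraphOf as H → m H ≡ proj₁ (continuants as)
m-isSnakeGraphOf empty      = refl
m-isSnakeGraphOf (one refl) = refl
m-isSnakeGraphOf {[]}                  (snake _ _ _ _ _ ())
m-isSnakeGraphOf {(zero , [ () ]) ∷ _} (snake _ _ _ _ _ _)
m-isSnakeGraphOf {(suc k , _) ∷ as}    (snake ts f last s signs eq) = begin
  m (snakeGraph ts)                                                ≡⟨ m-snakeGraph last ts signs ⟩
  profile (signSequence f ts last) (opposite (f (south origin)))
    -- The heads of the two sign sequences identify the sign of the first south edge with `s`.
    ≡⟨ cong₂ (λ σs σ → profile σs (opposite σ)) eq (∷-injectiveˡ eq) ⟩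
  profile (s ∷ replicate k s ++ blocks (opposite s) as) (opposite s)
    ≡⟨ cong proj₁ (profile-blocks s k as) ⟩
  proj₁ (step (suc k) (continuants as))                            ∎
  where open ≡-Reasoning

m-𝒢 : ∀ as → m 𝒢[ as ] ≡ proj₁ (continuants as)
m-𝒢 as = m-isSnakeGraphOf (proj₂ (exists as))

-- Palindromes and the sum of squares

infix 7 _·_
_·_ : ℕ × ℕ → ℕ × ℕ → ℕ
(u , v) · (u′ , v′) = u * u′ + v * v′

step-symmetric : ∀ a x y → x · step a y ≡ step a x · y
step-symmetric a (u , v) (u′ , v′) = identity a u v u′ v′
  where
  identity : ∀ a u v u′ v′ → u * (a * u′ + v′) + v * u′ ≡ (a * u + v) * u′ + u * v′
  identity = solve-∀

foldl-foldr-adjoint : ∀ (as : List ℕ⁺) x y →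
  x · foldl (flip (step ∘ value)) y as ≡ foldr (step ∘ value) x as · y
foldl-foldr-adjoint []       x y = refl
foldl-foldr-adjoint (a ∷ as) x y = trans (foldl-foldr-adjoint as x (step (value a) y))
  (step-symmetric (value a) (foldr (step ∘ value) x as) y)

continuants-palindrome : ∀ as → proj₁ (continuants (reverse as ++ as)) ≡
                         proj₁ (continuants as) ^ 2 + proj₂ (continuants as) ^ 2
continuants-palindrome as = begin
  proj₁ (continuants (reverse as ++ as))
    -- The vector `(1 , 0)` selects the first entry and is also the seed of `continuants`, so moving
    -- all matrices across yields `continuants as` a second time.
    ≡⟨ first (continuants (reverse as ++ as)) ⟩
  (1 , 0) · continuants (reverse as ++ as)
    ≡⟨ cong ((1 , 0) ·_) (foldr-++ (step ∘ value) (1 , 0) (reverse as) as) ⟩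
  (1 , 0) · foldr (step ∘ value) (continuants as) (reverse as)
    ≡⟨ cong ((1 , 0) ·_) (reverse-foldr (step ∘ value) (continuants as) as) ⟩
  (1 , 0) · foldl (flip (step ∘ value)) (continuants as) as
    ≡⟨ foldl-foldr-adjoint as (1 , 0) (continuants as) ⟩
  continuants as · continuants as
    ≡⟨ squares (proj₁ (continuants as)) (proj₂ (continuants as)) ⟩
  proj₁ (continuants as) ^ 2 + proj₂ (continuants as) ^ 2 ∎
  where
  open ≡-Reasoning
  first : ∀ x → proj₁ x ≡ (1 , 0) · x
  first (u , v) = sym (trans (+-identityʳ _) (*-identityˡ u))
  squares : ∀ u v → u * u + v * v ≡ u ^ 2 + v ^ 2
  squares u v = sym (cong₂ (λ a b → u * a + v * b) (*-identityʳ u) (*-identityʳ v))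

theorem3p9 : (a₁ : ℕ⁺) (as : List ℕ⁺) →
    m 𝒢[ reverse (a₁ ∷ as) ++ (a₁ ∷ as) ] ≡ m 𝒢[ a₁ ∷ as ] ^ 2 + m 𝒢[ as ] ^ 2
theorem3p9 a₁ as = begin
  m 𝒢[ reverse (a₁ ∷ as) ++ (a₁ ∷ as) ]                          ≡⟨ m-𝒢 (reverse (a₁ ∷ as) ++ (a₁ ∷ as)) ⟩
  proj₁ (continuants (reverse (a₁ ∷ as) ++ (a₁ ∷ as)))           ≡⟨ continuants-palindrome (a₁ ∷ as) ⟩
  -- The second entry of `continuants (a₁ ∷ as)` is by definition of `step` the first entry of
  -- `continuants as`.
  proj₁ (continuants (a₁ ∷ as)) ^ 2 + proj₁ (continuants as) ^ 2
    ≡⟨ sym (cong₂ (λ u v → u ^ 2 + v ^ 2) (m-𝒢 (a₁ ∷ as)) (m-𝒢 as)) ⟩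
  m 𝒢[ a₁ ∷ as ] ^ 2 + m 𝒢[ as ] ^ 2                            ∎
  where open ≡-Reasoning
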